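{- Let $\mathbf v\in\mathbb Z^4$ be nonzero and suppose the orbit $\mathcal A[\mathbf v]=\{\mathbf U\mathbf v:\mathbf U\in\mathcal A\}$ contains a root quadruple $\mathbf a$. Then: (1) $\mathbf a$ is the unique reduced quadruple in $\mathcal A[\mathbf v]$; (2) all values $L(\mathbf x)$, $\mathbf x\in\mathcal A[\mathbf v]$, are nonzero and have the same sign, and if this sign is positive, then the general reduction algorithm started from any $\mathbf x\in\mathcal A[\mathbf v]$ applies only $\mathbf S_4$ (to the quadruple ordered increasingly) until the root quadruple is reached.
   Context: $\mathbf S_1,\dots,\mathbf S_4$ are the $4\times4$ integer matrices acting on column vectors $(a_1,a_2,a_3,a_4)^T$ by replacing the $i$-th coordinate $a_i$ with $2\sum_{j\ne i}a_j-a_i$, other coordinates fixed. The Apollonian group $\mathcal A$ is the subgroup of $GL(4,\mathbb Z)$ generated by $\mathbf S_1,\dots,\mathbf S_4$. For $\mathbf v=(a,b,c,d)$, $|\mathbf v|=|a|+|b|+|c|+|d|$ and $L(\mathbf v)=a+b+c+d$. General reduction algorithm: order the quadruple increasingly, then apply the first $\mathbf S_i$ ($i=1,2,3,4$ in order) that strictly decreases $|\mathbf v|$, and repeat; halt when no $\mathbf S_i$ strictly decreases $|\mathbf v|$. A quadruple is reduced if no $\mathbf S_i$ strictly decreases $|\mathbf v|$. A reduced quadruple $\mathbf a$, ordered as $a\le b\le c\le d$, with $L(\mathbf a)\ge0$ is a root quadruple if $a+b+c\ge d>0$; a reduced $\mathbf a$ with $L(\mathbf a)<0$ is a root quadruple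 if $(-d,-c,-b,-a)$ is one. -}

module Defs where

open import Data.Fin.Base using (Fin) renaming (_<_ to _<ᶠ_)
open import Data.Fin.Patterns using (0F; 1F; 2F; 3F)
open import Data.Fin.Properties using () renaming (_≟_ to _≟ᶠ_)
open import Data.Integer.Base using (ℤ; 0ℤ; 1ℤ; +_; -_; _+_; _*_; _≤_; _<_; ∣_∣)
open import Data.Integer.Properties using (≤-totalOrder)
open import Data.List.Base using (List; []; _∷_)
open import Data.List.Relation.Binary.Permutation.Propositional using (_↭_)
open import Data.List.Relation.Unary.Sorted.TotalOrder ≤-totalOrder using (Sorted)
open import Data.Nat.Base using (ℕ) renaming (_+_ to _+ᴺ_; _<_ to _<ᴺ_)
open import Data.Product.Base using (∃-syntax; _×_)
open import Data.Sum.Base using (_⊎_)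
open import Data.Vec.Base using (Vec; []; _∷_; map; zipWith; foldr′; tabulate; transpose; toList)
open import Data.Bool.Base using (if_then_else_)
open import Relation.Binary.PropositionalEquality.Core using (_≡_)
open import Relation.Nullary.Decidable.Core using (does)
open import Relation.Nullary.Negation.Core using (¬_)

Quad : Set
Quad = Vec ℤ 4

-- Matrices are stored by rows.
Matrix : Set
Matrix = Vec (Vec ℤ 4) 4

dot : Quad → Quad → ℤ
dot u v = foldr′ _+_ 0ℤ (zipWith _*_ u v)

infixr 8 _·_
infixl 7 _⊗_

_·_ : Matrix → Quad → Quad
U · v = map (λ row → dot row v) U

_⊗_ : Matrix → Matrix → Matrix
U ⊗ V = map (λ row → map (dot row) (transpose V)) U

𝟙 : Matrix
𝟙 = tabulate λ i → tabulate λ j → if does (i ≟ᶠ j) then 1ℤ else 0ℤ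

-- Indices start at 0F, so S 0F, …, S 3F are the matrices S₁, …, S₄.
S : Fin 4 → Matrix
S 0F = (- 1ℤ ∷ + 2 ∷ + 2 ∷ + 2 ∷ [])
     ∷ (0ℤ ∷ 1ℤ ∷ 0ℤ ∷ 0ℤ ∷ [])
     ∷ (0ℤ ∷ 0ℤ ∷ 1ℤ ∷ 0ℤ ∷ [])
     ∷ (0ℤ ∷ 0ℤ ∷ 0ℤ ∷ 1ℤ ∷ []) ∷ []
S 1F = (1ℤ ∷ 0ℤ ∷ 0ℤ ∷ 0ℤ ∷ [])
     ∷ (+ 2 ∷ - 1ℤ ∷ + 2 ∷ + 2 ∷ [])
     ∷ (0ℤ ∷ 0ℤ ∷ 1ℤ ∷ 0ℤ ∷ [])
     ∷ (0ℤ ∷ 0ℤ ∷ 0ℤ ∷ 1ℤ ∷ []) ∷ []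
S 2F = (1ℤ ∷ 0ℤ ∷ 0ℤ ∷ 0ℤ ∷ [])
     ∷ (0ℤ ∷ 1ℤ ∷ 0ℤ ∷ 0ℤ ∷ [])
     ∷ (+ 2 ∷ + 2 ∷ - 1ℤ ∷ + 2 ∷ [])
     ∷ (0ℤ ∷ 0ℤ ∷ 0ℤ ∷ 1ℤ ∷ []) ∷ []
S 3F = (1ℤ ∷ 0ℤ ∷ 0ℤ ∷ 0ℤ ∷ [])
     ∷ (0ℤ ∷ 1ℤ ∷ 0ℤ ∷ 0ℤ ∷ [])
     ∷ (0ℤ ∷ 0ℤ ∷ 1ℤ ∷ 0ℤ ∷ [])
     ∷ (+ 2 ∷ + 2 ∷ + 2 ∷ - 1ℤ ∷ []) ∷ []

-- The subgroup of GL(4,ℤ) generated by the S i, as a predicate on matrices.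
data Apollonian : Matrix → Set where
  generator : ∀ i → Apollonian (S i)
  identity  : Apollonian 𝟙
  multiply  : ∀ {U V} → Apollonian U → Apollonian V → Apollonian (U ⊗ V)
  inverse   : ∀ {U V} → Apollonian U → U ⊗ V ≡ 𝟙 → V ⊗ U ≡ 𝟙 → Apollonian V

infix 4 _∈𝒜[_]

_∈𝒜[_] : Quad → Quad → Set
x ∈𝒜[ v ] = ∃[ U ] (Apollonian U × x ≡ U · v)

‖_‖ : Quad → ℕ
‖ a ∷ b ∷ c ∷ d ∷ [] ‖ = ∣ a ∣ +ᴺ ∣ b ∣ +ᴺ ∣ c ∣ +ᴺ ∣ d ∣

L : Quad → ℤ
L (a ∷ b ∷ c ∷ d ∷ []) = a + b + c + d

Decreases : Fin 4 → Quad → Set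
Decreases i v = ‖ S i · v ‖ <ᴺ ‖ v ‖

Reduced : Quad → Set
Reduced v = ∀ i → ¬ Decreases i v

-- w is the increasing rearrangement of v.
infix 4 _Orders_

_Orders_ : Quad → Quad → Set
w Orders v = Sorted (toList w) × toList w ↭ toList v

-- Being a root quadruple does not depend on the order of the entries: the
-- inequalities are imposed on the increasing rearrangement.
Root⁺ : Quad → Set
Root⁺ v = Reduced v × 0ℤ ≤ L v ×
  ∃[ a ] ∃[ b ] ∃[ c ] ∃[ d ]
    ((a ∷ b ∷ c ∷ d ∷ []) Orders v × d ≤ a + b + c × 0ℤ < d)

Root⁻ : Quad → Set
Root⁻ v = Reduced v × L v < 0ℤ ×
  ∃[ a ] ∃[ b ] ∃[ c ] ∃[ d ]
    ((a ∷ b ∷ c ∷ d ∷ []) Orders v × Root⁺ (- d ∷ - c ∷ - b ∷ - a ∷ []))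

Root : Quad → Set
Root v = Root⁺ v ⊎ Root⁻ v

FirstDecreasing : Fin 4 → Quad → Set
FirstDecreasing i w = Decreases i w × (∀ j → j <ᶠ i → ¬ Decreases j w)

-- Run x is r: the general reduction algorithm started from x applies the
-- matrices S i for i in the list is, in that order, and halts with output r
-- (ordered increasingly). The quadruple is reordered before every step.
data Run : Quad → List (Fin 4) → Quad → Set where
  halt : ∀ {x w} → w Orders x → Reduced w → Run x [] w
  step : ∀ {x w i is r} → w Orders x → FirstDecreasing i w →
         Run (S i · w) is r → Run x (i ∷ is) r

{-# OPTIONS --safe #-}
module Submission where

-- Put αᵢ(x) = L(x) − 2xᵢ. Then Sᵢ x = x + 2αᵢ(x)eᵢ, so Sᵢ negates αᵢ, adds 2αᵢ
-- to every other αⱼ and adds 2αᵢ to L: the Sᵢ act as the simple reflections of a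
-- Coxeter group, and a root quadruple (up to sign) is a point of the closed
-- fundamental chamber, where all αᵢ ≥ 0. Every orbit point is reached from it by
-- reflections applied while αᵢ ≥ 0. Along such an ascent L never decreases and
-- αᵢ + αⱼ ≥ 0 persists for i ≠ j; hence L > 0 on the orbit, the chamber contains
-- a single orbit point, and at most one αᵢ is negative elsewhere. Finally L > 0 at
-- both x and Sᵢ x makes the old and new i-th entries have positive sum, so Sᵢ
-- decreases |x| exactly when αᵢ < 0, which in a sorted quadruple forces i = 4.

open import Defs
open import Data.Fin.Base using (Fin; zero; suc)
open import Data.Fin.Patterns using (0F; 1F; 2F; 3F)
open import Data.Fin.Properties using () renaming (_≟_ to _≟ᶠ_; <-irrefl to <ᶠ-irrefl)
open import Data.Integer.Base using (ℤ; 0ℤ; +_; -_; _+_; _-_; _*_; _≤_; _<_; ∣_∣; -[1+_]; -≤+)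
open import Data.Integer.Properties as ℤ using (≤-totalOrder; ≤-decTotalOrder)
open import Data.Integer.Tactic.RingSolver using (solve-∀)
import Data.List.Base as List
open import Data.List.Base using (List; []; _∷_)
open import Data.List.Relation.Binary.Permutation.Propositional using (_↭_; prep; swap; ↭-refl; ↭-sym; ↭-trans; ↭-reflexive; ↭⇒↭ₛ)
open import Data.List.Relation.Binary.Permutation.Propositional.Properties using (map⁺; drop-∷; ↭-length; ↭-reverse)
import Data.List.Relation.Binary.Permutation.Setoid.Properties as ↭ₛ
open import Data.List.Relation.Unary.All using (All; []; _∷_)
open import Data.List.Relation.Unary.Linked using ([-]; _∷_)
open import Data.List.Relation.Unary.Sorted.TotalOrder ≤-totalOrder using (Sorted)
open import Data.List.Sort ≤-decTotalOrder using (sort; sort-↭; sort-↗)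
open import Data.Nat.Base using (suc) renaming (_+_ to _+ᴺ_; _<_ to _<ᴺ_; _≤_ to _≤ᴺ_)
open import Data.Nat.Induction using (<-wellFounded)
open import Data.Nat.ListAction using (sum)
open import Data.Nat.ListAction.Properties using (sum-↭)
import Data.Nat.Properties as ℕ
import Data.Nat.Tactic.RingSolver as ℕ-Solver
open import Data.Product.Base using (∃-syntax; Σ-syntax; _×_; _,_; proj₁; proj₂)
open import Data.Sum.Base using (_⊎_; inj₁; inj₂)
open import Data.Vec.Base using (Vec; []; _∷_; lookup; map; zipWith; replicate; removeAt; transpose; toList; _[_]≔_)
open import Data.Vec.Properties using (lookup∘update; lookup∘update′; []≔-lookup; []≔-idempotent; lookup-map; map-[]≔; toList-map; length-toList)
open import Function.Base using (_∘_)
open import Function.Bundles using (Inverse)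
open import Induction.WellFounded using (Acc; acc)
open import Relation.Binary.PropositionalEquality using (_≡_; _≢_; refl; sym; trans; cong; cong₂; subst; subst₂; setoid)
open import Data.List.Relation.Binary.Permutation.Setoid (setoid ℤ) using (onIndices)
open import Relation.Nullary.Decidable.Core using (yes; no)
open import Relation.Nullary.Negation.Core using (contradiction)

-- The reflections and the matrix action.

quad-≡ : ∀ {a b c d a′ b′ c′ d′ : ℤ} → a ≡ a′ → b ≡ b′ → c ≡ c′ → d ≡ d′ →
         _≡_ {A = Quad} (a ∷ b ∷ c ∷ d ∷ []) (a′ ∷ b′ ∷ c′ ∷ d′ ∷ [])
quad-≡ refl refl refl refl = refl

α : Fin 4 → Quad → ℤ
α i x = L x - (lookup x i + lookup x i)

-- Encoded as an update of a single entry, so that general facts about vector updates replace matrix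
-- computations.
s : Fin 4 → Quad → Quad
s i x = x [ i ]≔ (lookup x i + (α i x + α i x))

dot-e₀ : ∀ a b c d → + 1 * a + (+ 0 * b + (+ 0 * c + (+ 0 * d + + 0))) ≡ a
dot-e₀ = solve-∀

dot-e₁ : ∀ a b c d → + 0 * a + (+ 1 * b + (+ 0 * c + (+ 0 * d + + 0))) ≡ b
dot-e₁ = solve-∀

dot-e₂ : ∀ a b c d → + 0 * a + (+ 0 * b + (+ 1 * c + (+ 0 * d + + 0))) ≡ c
dot-e₂ = solve-∀

dot-e₃ : ∀ a b c d → + 0 * a + (+ 0 * b + (+ 0 * c + (+ 1 * d + + 0))) ≡ d
dot-e₃ = solve-∀

𝟙·x≡x : ∀ x → 𝟙 · x ≡ x
𝟙·x≡x (a ∷ b ∷ c ∷ d ∷ []) = quad-≡ (dot-e₀ a b c d) (dot-e₁ a b c d) (dot-e₂ a b c d) (dot-e₃ a b c d)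

S·x≡s : ∀ i x → S i · x ≡ s i x
S·x≡s 0F (a ∷ b ∷ c ∷ d ∷ []) = quad-≡ (eq a b c d) (dot-e₁ a b c d) (dot-e₂ a b c d) (dot-e₃ a b c d)
  where
  eq : ∀ a b c d → (- + 1) * a + (+ 2 * b + (+ 2 * c + (+ 2 * d + + 0)))
       ≡ a + ((a + b + c + d - (a + a)) + (a + b + c + d - (a + a)))
  eq = solve-∀
S·x≡s 1F (a ∷ b ∷ c ∷ d ∷ []) = quad-≡ (dot-e₀ a b c d) (eq a b c d) (dot-e₂ a b c d) (dot-e₃ a b c d)
  where
  eq : ∀ a b c d → + 2 * a + ((- + 1) * b + (+ 2 * c + (+ 2 * d + + 0)))
       ≡ b + ((a + b + c + d - (b + b)) + (a + b + c + d - (b + b)))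
  eq = solve-∀
S·x≡s 2F (a ∷ b ∷ c ∷ d ∷ []) = quad-≡ (dot-e₀ a b c d) (dot-e₁ a b c d) (eq a b c d) (dot-e₃ a b c d)
  where
  eq : ∀ a b c d → + 2 * a + (+ 2 * b + ((- + 1) * c + (+ 2 * d + + 0)))
       ≡ c + ((a + b + c + d - (c + c)) + (a + b + c + d - (c + c)))
  eq = solve-∀
S·x≡s 3F (a ∷ b ∷ c ∷ d ∷ []) = quad-≡ (dot-e₀ a b c d) (dot-e₁ a b c d) (dot-e₂ a b c d) (eq a b c d)
  where
  eq : ∀ a b c d → + 2 * a + (+ 2 * b + (+ 2 * c + ((- + 1) * d + + 0)))
       ≡ d + ((a + b + c + d - (d + d)) + (a + b + c + d - (d + d)))
  eq = solve-∀

axpy : ℤ → Quad → Quad → Quad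
axpy r = zipWith λ p q → r * p + q

dot-axpy : ∀ r u t y → dot (axpy r u t) y ≡ r * dot u y + dot t y
dot-axpy r (u₀ ∷ u₁ ∷ u₂ ∷ u₃ ∷ []) (t₀ ∷ t₁ ∷ t₂ ∷ t₃ ∷ []) (y₀ ∷ y₁ ∷ y₂ ∷ y₃ ∷ []) =
  eq r u₀ u₁ u₂ u₃ t₀ t₁ t₂ t₃ y₀ y₁ y₂ y₃
  where
  eq : ∀ r u₀ u₁ u₂ u₃ t₀ t₁ t₂ t₃ y₀ y₁ y₂ y₃ →
       (r * u₀ + t₀) * y₀ + ((r * u₁ + t₁) * y₁ + ((r * u₂ + t₂) * y₂ + ((r * u₃ + t₃) * y₃ + + 0)))
       ≡ r * (u₀ * y₀ + (u₁ * y₁ + (u₂ * y₂ + (u₃ * y₃ + + 0))))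
         + (t₀ * y₀ + (t₁ * y₁ + (t₂ * y₂ + (t₃ * y₃ + + 0))))
  eq = solve-∀

dot-zero : ∀ y → dot (replicate 4 0ℤ) y ≡ 0ℤ
dot-zero (_ ∷ _ ∷ _ ∷ _ ∷ []) = refl

-- With `r` and the rows of `V` in constructor form, `map (dot r) (transpose V)` unfolds to r₀u₀ +
-- (r₁u₁ + (r₂u₂ + (r₃u₃ + 0))). Linearity is then applied one row at a time; the final zero vector
-- comes from the `0ℤ` that ends each `dot`.
dot-transpose : ∀ (r : Quad) V y → dot (map (dot r) (transpose V)) y ≡ dot r (V · y)
dot-transpose (r₀ ∷ r₁ ∷ r₂ ∷ r₃ ∷ [])
  (u₀@(_ ∷ _ ∷ _ ∷ _ ∷ []) ∷ u₁@(_ ∷ _ ∷ _ ∷ _ ∷ []) ∷ u₂@(_ ∷ _ ∷ _ ∷ _ ∷ []) ∷ u₃@(_ ∷ _ ∷ _ ∷ _ ∷ []) ∷ []) y =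
  trans (dot-axpy r₀ u₀ t₁ y) (cong (_+_ (r₀ * dot u₀ y))
  (trans (dot-axpy r₁ u₁ t₂ y) (cong (_+_ (r₁ * dot u₁ y))
  (trans (dot-axpy r₂ u₂ t₃ y) (cong (_+_ (r₂ * dot u₂ y))
  (trans (dot-axpy r₃ u₃ t₄ y) (cong (_+_ (r₃ * dot u₃ y))
  (dot-zero y))))))))
  where
  t₄ = replicate 4 0ℤ
  t₃ = axpy r₃ u₃ t₄
  t₂ = axpy r₂ u₂ t₃
  t₁ = axpy r₁ u₁ t₂

⊗-· : ∀ U V x → (U ⊗ V) · x ≡ U · (V · x)
⊗-· (u₀ ∷ u₁ ∷ u₂ ∷ u₃ ∷ []) V x =
  quad-≡ (dot-transpose u₀ V x) (dot-transpose u₁ V x) (dot-transpose u₂ V x) (dot-transpose u₃ V x)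

-- Effect of a reflection on `L` and on the `α i`.

L-update : ∀ (x : Quad) i y → L (x [ i ]≔ y) ≡ L x + (y - lookup x i)
L-update (a ∷ b ∷ c ∷ d ∷ []) 0F y = eq a b c d y
  where
  eq : ∀ a b c d y → y + b + c + d ≡ a + b + c + d + (y - a)
  eq = solve-∀
L-update (a ∷ b ∷ c ∷ d ∷ []) 1F y = eq a b c d y
  where
  eq : ∀ a b c d y → a + y + c + d ≡ a + b + c + d + (y - b)
  eq = solve-∀
L-update (a ∷ b ∷ c ∷ d ∷ []) 2F y = eq a b c d y
  where
  eq : ∀ a b c d y → a + b + y + d ≡ a + b + c + d + (y - c)
  eq = solve-∀
L-update (a ∷ b ∷ c ∷ d ∷ []) 3F y = eq a b c d y
  where
  eq : ∀ a b c d y → a + b + c + y ≡ a + b + c + d + (y - d)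
  eq = solve-∀

L-s : ∀ i x → L (s i x) ≡ L x + (α i x + α i x)
L-s i x = trans (L-update x i _) (cong (_+_ (L x)) (eq (lookup x i) (α i x)))
  where
  eq : ∀ z t → z + (t + t) - z ≡ t + t
  eq = solve-∀

lookup-s : ∀ i x → lookup (s i x) i ≡ lookup x i + (α i x + α i x)
lookup-s i x = lookup∘update i x _

α-s : ∀ i x → α i (s i x) ≡ - α i x
α-s i x = trans (cong₂ (λ l z → l - (z + z)) (L-s i x) (lookup-s i x)) (eq (L x) (lookup x i))
  where
  eq : ∀ l z → l + ((l - (z + z)) + (l - (z + z)))
                 - (z + ((l - (z + z)) + (l - (z + z))) + (z + ((l - (z + z)) + (l - (z + z)))))
               ≡ - (l - (z + z))
  eq = solve-∀

α-s-≢ : ∀ {i j} → j ≢ i → ∀ x → α j (s i x) ≡ α j x + (α i x + α i x)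
α-s-≢ {i} {j} j≢i x =
  trans (cong₂ (λ l z → l - (z + z)) (L-s i x) (lookup∘update′ j≢i x _)) (eq (L x) (lookup x j) (α i x))
  where
  eq : ∀ l z t → l + (t + t) - (z + z) ≡ l - (z + z) + (t + t)
  eq = solve-∀

s-involutive : ∀ i x → s i (s i x) ≡ x
s-involutive i x = trans (cong (s i x [ i ]≔_) (trans
    (cong₂ (λ z t → z + (t + t)) (lookup-s i x) (α-s i x)) (eq (lookup x i) (α i x))))
  (trans ([]≔-idempotent x i) ([]≔-lookup x i))
  where
  eq : ∀ z t → z + (t + t) + (- t + - t) ≡ z
  eq = solve-∀

s-fixed : ∀ i x → α i x ≡ 0ℤ → s i x ≡ x
s-fixed i x α≡0 rewrite α≡0 | ℤ.+-identityʳ (lookup x i) = []≔-lookup x i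

-- From the generators to the whole group.

-- Both directions are proved together because `inverse` exchanges them: moving forward along V is
-- moving backward along U from V · x. For generators the backward direction comes from `s i` being
-- an involution.
𝒜-invariant : (P : Quad → Set) → (∀ i {x} → P x → P (s i x)) →
              ∀ {U} → Apollonian U → ∀ x → (P x → P (U · x)) × (P (U · x) → P x)
𝒜-invariant P closed = go
  where
  s-inverse : ∀ i {x} → P (s i x) → P x
  s-inverse i {x} p = subst P (s-involutive i x) (closed i p)

  go : ∀ {U} → Apollonian U → ∀ x → (P x → P (U · x)) × (P (U · x) → P x)
  go (generator i) x rewrite S·x≡s i x = closed i , s-inverse i
  go identity x rewrite 𝟙·x≡x x = (λ p → p) , (λ p → p)
  go (multiply {U} {V} g h) x rewrite ⊗-· U V x =
    (λ p → proj₁ (go g (V · x)) (proj₁ (go h x) p)) ,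
    (λ p → proj₂ (go h x) (proj₂ (go g (V · x)) p))
  go (inverse {U} {V} g UV≡𝟙 _) x =
    (λ p → proj₂ (go g (V · x)) (subst P (sym UVx≡x) p)) ,
    (λ p → subst P UVx≡x (proj₁ (go g (V · x)) p))
    where
    UVx≡x : U · (V · x) ≡ x
    UVx≡x = trans (sym (⊗-· U V x)) (trans (cong (_· x) UV≡𝟙) (𝟙·x≡x x))

-- Absolute values and the norm.

i≤+∣i∣ : ∀ i → i ≤ + ∣ i ∣
i≤+∣i∣ (+ n)    = ℤ.≤-refl
i≤+∣i∣ -[1+ n ] = -≤+

-- The second hypothesis says - u < v, so both candidates for ∣ u ∣ lie below v.
∣u∣<∣v∣ : ∀ {u v} → u < v → 0ℤ < u + v → ∣ u ∣ <ᴺ ∣ v ∣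
∣u∣<∣v∣ {u} {v} u<v 0<u+v = ℤ.drop‿+<+ (ℤ.<-≤-trans (bound (ℤ.+∣i∣≡i⊎+∣i∣≡-i u)) (i≤+∣i∣ v))
  where
  eq : ∀ u v → u + v + - u ≡ v
  eq = solve-∀
  bound : + ∣ u ∣ ≡ u ⊎ + ∣ u ∣ ≡ - u → + ∣ u ∣ < v
  bound (inj₁ e) = subst (_< v) (sym e) u<v
  bound (inj₂ e) = subst₂ _<_ (trans (ℤ.+-identityˡ (- u)) (sym e)) (eq u v) (ℤ.+-monoˡ-< (- u) 0<u+v)

∣u∣≤∣v∣ : ∀ {u v} → u ≤ v → 0ℤ ≤ u + v → ∣ u ∣ ≤ᴺ ∣ v ∣
∣u∣≤∣v∣ {u} {v} u≤v 0≤u+v = ℤ.drop‿+≤+ (ℤ.≤-trans (bound (ℤ.+∣i∣≡i⊎+∣i∣≡-i u)) (i≤+∣i∣ v))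
  where
  eq : ∀ u v → u + v + - u ≡ v
  eq = solve-∀
  bound : + ∣ u ∣ ≡ u ⊎ + ∣ u ∣ ≡ - u → + ∣ u ∣ ≤ v
  bound (inj₁ e) = subst (_≤ v) (sym e) u≤v
  bound (inj₂ e) = subst₂ _≤_ (trans (ℤ.+-identityˡ (- u)) (sym e)) (eq u v) (ℤ.+-monoˡ-≤ (- u) 0≤u+v)

-- Stated additively to avoid truncated subtraction.
‖‖-update : ∀ (x : Quad) i y → ‖ x [ i ]≔ y ‖ +ᴺ ∣ lookup x i ∣ ≡ ‖ x ‖ +ᴺ ∣ y ∣
‖‖-update (a ∷ b ∷ c ∷ d ∷ []) 0F y = eq (∣ a ∣) (∣ b ∣) (∣ c ∣) (∣ d ∣) (∣ y ∣)
  where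
  eq : ∀ a b c d y → y +ᴺ b +ᴺ c +ᴺ d +ᴺ a ≡ a +ᴺ b +ᴺ c +ᴺ d +ᴺ y
  eq = ℕ-Solver.solve-∀
‖‖-update (a ∷ b ∷ c ∷ d ∷ []) 1F y = eq (∣ a ∣) (∣ b ∣) (∣ c ∣) (∣ d ∣) (∣ y ∣)
  where
  eq : ∀ a b c d y → a +ᴺ y +ᴺ c +ᴺ d +ᴺ b ≡ a +ᴺ b +ᴺ c +ᴺ d +ᴺ y
  eq = ℕ-Solver.solve-∀
‖‖-update (a ∷ b ∷ c ∷ d ∷ []) 2F y = eq (∣ a ∣) (∣ b ∣) (∣ c ∣) (∣ d ∣) (∣ y ∣)
  where
  eq : ∀ a b c d y → a +ᴺ b +ᴺ y +ᴺ d +ᴺ c ≡ a +ᴺ b +ᴺ c +ᴺ d +ᴺ y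
  eq = ℕ-Solver.solve-∀
‖‖-update (a ∷ b ∷ c ∷ d ∷ []) 3F y = eq (∣ a ∣) (∣ b ∣) (∣ c ∣) (∣ d ∣) (∣ y ∣)
  where
  eq : ∀ a b c d y → a +ᴺ b +ᴺ c +ᴺ y +ᴺ d ≡ a +ᴺ b +ᴺ c +ᴺ d +ᴺ y
  eq = ℕ-Solver.solve-∀

‖‖-update-< : ∀ (x : Quad) i {y} → ∣ y ∣ <ᴺ ∣ lookup x i ∣ → ‖ x [ i ]≔ y ‖ <ᴺ ‖ x ‖
‖‖-update-< x i {y} lt = ℕ.+-cancelʳ-< (∣ lookup x i ∣) _ _
  (subst (_<ᴺ ‖ x ‖ +ᴺ ∣ lookup x i ∣) (sym (‖‖-update x i y)) (ℕ.+-monoʳ-< ‖ x ‖ lt))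

‖‖-update-≤ : ∀ (x : Quad) i {y} → ∣ lookup x i ∣ ≤ᴺ ∣ y ∣ → ‖ x ‖ ≤ᴺ ‖ x [ i ]≔ y ‖
‖‖-update-≤ x i {y} le = ℕ.+-cancelʳ-≤ (∣ lookup x i ∣) _ _
  (subst (‖ x ‖ +ᴺ ∣ lookup x i ∣ ≤ᴺ_) (sym (‖‖-update x i y)) (ℕ.+-monoʳ-≤ ‖ x ‖ le))

0<i+i⇒0<i : ∀ i → 0ℤ < i + i → 0ℤ < i
0<i+i⇒0<i i 0<i+i = ℤ.≰⇒> λ i≤0 → ℤ.<⇒≱ 0<i+i (ℤ.+-mono-≤ i≤0 i≤0)

-- (xᵢ + xᵢ′) + (xᵢ + xᵢ′) = L x + L (Sᵢ x), where xᵢ′ is the new i-th entry.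
lookup-sum-positive : ∀ i x → 0ℤ < L x → 0ℤ < L (s i x) →
                      0ℤ < lookup x i + (α i x + α i x) + lookup x i
lookup-sum-positive i x 0<L 0<Ls = 0<i+i⇒0<i _
  (subst (0ℤ <_) (trans (cong (_+_ (L x)) (L-s i x)) (eq (L x) (lookup x i))) (ℤ.+-mono-< 0<L 0<Ls))
  where
  eq : ∀ l z → l + (l + ((l - (z + z)) + (l - (z + z))))
       ≡ z + ((l - (z + z)) + (l - (z + z))) + z + (z + ((l - (z + z)) + (l - (z + z))) + z)
  eq = solve-∀

α<0⇒decreases : ∀ i x → 0ℤ < L x → 0ℤ < L (s i x) → α i x < 0ℤ → Decreases i x
α<0⇒decreases i x 0<L 0<Ls α<0 rewrite S·x≡s i x = ‖‖-update-< x i (∣u∣<∣v∣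
  (subst (lookup x i + (α i x + α i x) <_) (ℤ.+-identityʳ _) (ℤ.+-monoʳ-< (lookup x i) (ℤ.+-mono-< α<0 α<0)))
  (lookup-sum-positive i x 0<L 0<Ls))

decreases⇒α<0 : ∀ i x → 0ℤ < L x → 0ℤ < L (s i x) → Decreases i x → α i x < 0ℤ
decreases⇒α<0 i x 0<L 0<Ls dec rewrite S·x≡s i x = ℤ.≰⇒> λ 0≤α → ℕ.<⇒≱ dec (‖‖-update-≤ x i (∣u∣≤∣v∣ {lookup x i}
  (subst (_≤ lookup x i + (α i x + α i x)) (ℤ.+-identityʳ _) (ℤ.+-monoʳ-≤ (lookup x i) (ℤ.+-mono-≤ 0≤α 0≤α)))
  (subst (0ℤ ≤_) (ℤ.+-comm _ (lookup x i)) (ℤ.<⇒≤ (lookup-sum-positive i x 0<L 0<Ls)))))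

-- Ascents from the fundamental chamber.

-- The closed chamber without the origin: the four αᵢ sum to 2L, so if all are nonnegative then L >
-- 0 fails only at zero.
record Chamber (x : Quad) : Set where
  field
    α-nonneg   : ∀ i → 0ℤ ≤ α i x
    L-positive : 0ℤ < L x

open Chamber

-- Steps with αᵢ = 0 are allowed. They fix the point, and admitting them makes ascents closed under
-- every `s i`.
data Ascent (a : Quad) : Quad → Set where
  start : Ascent a a
  climb : ∀ {x} i → Ascent a x → 0ℤ ≤ α i x → Ascent a (s i x)

module _ {a : Quad} (chamber : Chamber a) where

  ascent-positive : ∀ {x} → Ascent a x → 0ℤ < L x
  ascent-positive start = L-positive chamber
  ascent-positive (climb {x} i p 0≤α) =
    subst (0ℤ <_) (sym (L-s i x)) (ℤ.+-mono-<-≤ (ascent-positive p) (ℤ.+-mono-≤ 0≤α 0≤α))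

  -- If k is one of i, j, a climb at k preserves the sum, as in - αₖ + (αⱼ + 2αₖ) = αₖ + αⱼ.
  -- Otherwise it adds 4αₖ ≥ 0.
  ascent-pairs : ∀ {x} → Ascent a x → ∀ {i j} → i ≢ j → 0ℤ ≤ α i x + α j x
  ascent-pairs start {i} {j} _ = ℤ.+-mono-≤ (α-nonneg chamber i) (α-nonneg chamber j)
  ascent-pairs (climb {x} k p 0≤α) {i} {j} i≢j with i ≟ᶠ k | j ≟ᶠ k
  ... | yes refl | yes refl = contradiction refl i≢j
  ... | yes refl | no j≢k =
    subst (0ℤ ≤_) (sym (trans (cong₂ _+_ (α-s k x) (α-s-≢ j≢k x)) (eq (α k x) (α j x)))) (ascent-pairs p i≢j)
    where
    eq : ∀ u v → - u + (v + (u + u)) ≡ u + v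
    eq = solve-∀
  ... | no i≢k | yes refl =
    subst (0ℤ ≤_) (sym (trans (cong₂ _+_ (α-s-≢ i≢k x) (α-s k x)) (eq (α i x) (α k x)))) (ascent-pairs p i≢j)
    where
    eq : ∀ u v → u + (v + v) + - v ≡ u + v
    eq = solve-∀
  ... | no i≢k | no j≢k =
    subst (0ℤ ≤_) (sym (trans (cong₂ _+_ (α-s-≢ i≢k x) (α-s-≢ j≢k x)) (eq (α i x) (α j x) (α k x))))
      (ℤ.+-mono-≤ (ascent-pairs p i≢j) (ℤ.+-mono-≤ (ℤ.+-mono-≤ 0≤α 0≤α) (ℤ.+-mono-≤ 0≤α 0≤α)))
    where
    eq : ∀ u v t → u + (t + t) + (v + (t + t)) ≡ u + v + (t + t + (t + t))
    eq = solve-∀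

  -- Repeating the last index undoes the last climb. A different index i after a climb at j sees the
  -- value αᵢ + 2αⱼ = (αᵢ + αⱼ) + αⱼ, which is nonnegative by `ascent-pairs`, so it is again a
  -- climb.
  ascent-s : ∀ i {x} → Ascent a x → Ascent a (s i x)
  ascent-s i start = climb i start (α-nonneg chamber i)
  ascent-s i (climb {x} j p 0≤α) with i ≟ᶠ j
  ... | yes refl = subst (Ascent a) (sym (s-involutive i x)) p
  ... | no i≢j = climb i (climb j p 0≤α)
    (subst (0ℤ ≤_) (sym (trans (α-s-≢ i≢j x) (sym (ℤ.+-assoc (α i x) _ _))))
      (ℤ.+-mono-≤ (ascent-pairs p i≢j) 0≤α))

  ascent-unique : ∀ {x} → Ascent a x → (∀ i → 0ℤ ≤ α i x) → x ≡ a
  ascent-unique start _ = refl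
  ascent-unique (climb {x} i p 0≤α) nonneg =
    trans fixed (ascent-unique p λ j → subst (λ y → 0ℤ ≤ α j y) fixed (nonneg j))
    where
    fixed : s i x ≡ x
    fixed = s-fixed i x (ℤ.≤-antisym (ℤ.neg-cancel-≤ (subst (0ℤ ≤_) (α-s i x) (nonneg i))) 0≤α)

  ascent-reduced : ∀ {x} → Ascent a x → Reduced x → x ≡ a
  ascent-reduced {x} p red = ascent-unique p λ i → ℤ.≮⇒≥ λ α<0 →
    red i (α<0⇒decreases i x (ascent-positive p) (ascent-positive (ascent-s i p)) α<0)

-- The base point `v` is arbitrary: invariance carries the property backward from `a` to `v`, then
-- forward to `x`.
orbit⊆ascent : ∀ {a v} → Chamber a → a ∈𝒜[ v ] → ∀ x → x ∈𝒜[ v ] → Ascent a x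
orbit⊆ascent {a} {v} chamber (U , g , refl) x (V , h , refl) =
  proj₁ (𝒜-invariant (Ascent a) (ascent-s chamber) h v)
    (proj₂ (𝒜-invariant (Ascent a) (ascent-s chamber) g v) start)

-- Change of sign.

neg : Quad → Quad
neg = map (-_)

L-neg : ∀ x → L (neg x) ≡ - L x
L-neg (a ∷ b ∷ c ∷ d ∷ []) = eq a b c d
  where
  eq : ∀ a b c d → - a + - b + - c + - d ≡ - (a + b + c + d)
  eq = solve-∀

α-neg : ∀ i x → α i (neg x) ≡ - α i x
α-neg i x = trans (cong₂ (λ l z → l - (z + z)) (L-neg x) (lookup-map i (-_) x)) (eq (L x) (lookup x i))
  where
  eq : ∀ l z → - l - (- z + - z) ≡ - (l - (z + z))
  eq = solve-∀

neg-s : ∀ i x → s i (neg x) ≡ neg (s i x)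
neg-s i x = trans
  (cong (neg x [ i ]≔_) (trans (cong₂ (λ z t → z + (t + t)) (lookup-map i (-_) x) (α-neg i x)) (eq (lookup x i) (α i x))))
  (sym (map-[]≔ (-_) x i))
  where
  eq : ∀ z t → - z + (- t + - t) ≡ - (z + (t + t))
  eq = solve-∀

neg-involutive : ∀ x → neg (neg x) ≡ x
neg-involutive (a ∷ b ∷ c ∷ d ∷ []) =
  quad-≡ (ℤ.neg-involutive a) (ℤ.neg-involutive b) (ℤ.neg-involutive c) (ℤ.neg-involutive d)

‖‖-neg : ∀ x → ‖ neg x ‖ ≡ ‖ x ‖
‖‖-neg (a ∷ b ∷ c ∷ d ∷ [])
  rewrite ℤ.∣-i∣≡∣i∣ a | ℤ.∣-i∣≡∣i∣ b | ℤ.∣-i∣≡∣i∣ c | ℤ.∣-i∣≡∣i∣ d = refl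

-- Negation commutes with each `S i` and preserves the norm.
reduced-neg : ∀ {x} → Reduced x → Reduced (neg x)
reduced-neg {x} red i dec = red i (subst₂ _<ᴺ_
  (trans (cong ‖_‖ (trans (S·x≡s i (neg x)) (trans (neg-s i x) (cong neg (sym (S·x≡s i x)))))) (‖‖-neg (S i · x)))
  (‖‖-neg x) dec)

orbit⊆-ascent : ∀ {a v} → Chamber (neg a) → a ∈𝒜[ v ] → ∀ x → x ∈𝒜[ v ] → Ascent (neg a) (neg x)
orbit⊆-ascent {a} {v} chamber (U , g , refl) x (V , h , refl) =
  proj₁ (𝒜-invariant P closed h v) (proj₂ (𝒜-invariant P closed g v) start)
  where
  P : Quad → Set
  P y = Ascent (neg a) (neg y)
  closed : ∀ i {y} → P y → P (s i y)
  closed i {y} p = subst (Ascent (neg a)) (neg-s i y) (ascent-s chamber i p)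

-- Rearrangements of a quadruple.

sumℤ : List ℤ → ℤ
sumℤ = List.foldr _+_ 0ℤ

L≡sum : ∀ x → L x ≡ sumℤ (toList x)
L≡sum (a ∷ b ∷ c ∷ d ∷ []) = eq a b c d
  where
  eq : ∀ a b c d → a + b + c + d ≡ a + (b + (c + (d + + 0)))
  eq = solve-∀

L-↭ : ∀ w x → toList w ↭ toList x → L w ≡ L x
L-↭ w x p = trans (L≡sum w)
  (trans (↭ₛ.foldr-commMonoid (setoid ℤ) ℤ.+-0-isCommutativeMonoid (↭⇒↭ₛ p)) (sym (L≡sum x)))

‖‖≡sum : ∀ x → ‖ x ‖ ≡ sum (List.map ∣_∣ (toList x))
‖‖≡sum (a ∷ b ∷ c ∷ d ∷ []) = eq (∣ a ∣) (∣ b ∣) (∣ c ∣) (∣ d ∣)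
  where
  eq : ∀ a b c d → a +ᴺ b +ᴺ c +ᴺ d ≡ a +ᴺ (b +ᴺ (c +ᴺ (d +ᴺ 0)))
  eq = ℕ-Solver.solve-∀

‖‖-↭ : ∀ w x → toList w ↭ toList x → ‖ w ‖ ≡ ‖ x ‖
‖‖-↭ w x p = trans (‖‖≡sum w) (trans (sum-↭ (map⁺ ∣_∣ p)) (sym (‖‖≡sum x)))

lookup-toList : ∀ (a b c d : ℤ) i →
                List.lookup (a ∷ b ∷ c ∷ d ∷ []) i ≡ lookup (a ∷ b ∷ c ∷ d ∷ []) i
lookup-toList a b c d 0F = refl
lookup-toList a b c d 1F = refl
lookup-toList a b c d 2F = refl
lookup-toList a b c d 3F = refl

-- Injectivity serves to keep distinct indices distinct when `ascent-pairs` is transported.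
↭⇒indices : ∀ (w x : Quad) → toList w ↭ toList x →
            Σ[ σ ∈ (Fin 4 → Fin 4) ] ((∀ {i j} → σ i ≡ σ j → i ≡ j) × (∀ i → lookup w i ≡ lookup x (σ i)))
↭⇒indices (a ∷ b ∷ c ∷ d ∷ []) (a′ ∷ b′ ∷ c′ ∷ d′ ∷ []) p =
  Inverse.to π ,
  (λ {i} {j} e → trans (sym (Inverse.strictlyInverseʳ π i)) (trans (cong (Inverse.from π) e) (Inverse.strictlyInverseʳ π j))) ,
  λ i → trans (sym (lookup-toList a b c d i))
    (trans (↭ₛ.onIndices-lookup (setoid ℤ) (↭⇒↭ₛ p) i) (lookup-toList a′ b′ c′ d′ (Inverse.to π i)))
  where π = onIndices (↭⇒↭ₛ p)

update-↭ : ∀ {A : Set} {n} (xs : Vec A (suc n)) i y → toList (xs [ i ]≔ y) ↭ y ∷ toList (removeAt xs i)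
update-↭ (x ∷ xs)         zero    y = ↭-refl
update-↭ (x ∷ xs@(_ ∷ _)) (suc i) y = ↭-trans (prep x (update-↭ xs i y)) (swap x y ↭-refl)

lookup-↭ : ∀ {A : Set} {n} (xs : Vec A (suc n)) i → toList xs ↭ lookup xs i ∷ toList (removeAt xs i)
lookup-↭ xs i = subst (λ ys → toList ys ↭ lookup xs i ∷ toList (removeAt xs i)) ([]≔-lookup xs i) (update-↭ xs i _)

α-↭ : ∀ w x {i j} → toList w ↭ toList x → lookup w i ≡ lookup x j → α i w ≡ α j x
α-↭ w x p e = cong₂ (λ l z → l - (z + z)) (L-↭ w x p) e

-- The new entry depends only on the old one and on L, so equal entries are replaced by equal
-- entries; cancelling the old ones leaves rearranged remainders.
s-↭ : ∀ w x {i j} → toList w ↭ toList x → lookup w i ≡ lookup x j → toList (s i w) ↭ toList (s j x)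
s-↭ w x {i} {j} p e =
  ↭-trans (update-↭ w i _)
  (↭-trans (subst (λ z → _ ∷ toList (removeAt w i) ↭ z ∷ toList (removeAt x j))
             (cong₂ (λ z t → z + (t + t)) e (α-↭ w x p e)) (prep _ rest))
  (↭-sym (update-↭ x j _)))
  where
  rest : toList (removeAt w i) ↭ toList (removeAt x j)
  rest = drop-∷ (↭-trans (↭-sym (lookup-↭ w i))
    (↭-trans p (subst (λ z → toList x ↭ z ∷ toList (removeAt x j)) (sym e) (lookup-↭ x j))))

chamber-↭ : ∀ w x → toList w ↭ toList x → Chamber x → Chamber w
chamber-↭ w x p chamber = let σ , _ , e = ↭⇒indices w x p in record
  { α-nonneg   = λ i → subst (0ℤ ≤_) (sym (α-↭ w x p (e i))) (α-nonneg chamber (σ i))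
  ; L-positive = subst (0ℤ <_) (sym (L-↭ w x p)) (L-positive chamber)
  }

-- Root quadruples lie in the chamber, up to sign.

sorted⇒≤last : ∀ (w : Quad) → Sorted (toList w) → ∀ i → lookup w i ≤ lookup w 3F
sorted⇒≤last (a ∷ b ∷ c ∷ d ∷ []) (a≤b ∷ b≤c ∷ c≤d ∷ [-]) = λ where
  0F → ℤ.≤-trans a≤b (ℤ.≤-trans b≤c c≤d)
  1F → ℤ.≤-trans b≤c c≤d
  2F → c≤d
  3F → ℤ.≤-refl

α-antitone : ∀ (x : Quad) {i j} → lookup x i ≤ lookup x j → α j x ≤ α i x
α-antitone x le = ℤ.+-monoʳ-≤ (L x) (ℤ.neg-mono-≤ (ℤ.+-mono-≤ le le))

-- In increasing order the last α is the least, and it equals a + b + c - d.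
root⁺⇒chamber : ∀ {x} → Root⁺ x → Chamber x
root⁺⇒chamber {x} (_ , _ , a , b , c , d , (sorted , w↭x) , d≤a+b+c , 0<d) =
  chamber-↭ x w (↭-sym w↭x) record
    { α-nonneg   = λ i → ℤ.≤-trans 0≤α₃ (α-antitone w {i} {3F} (sorted⇒≤last w sorted i))
    ; L-positive = ℤ.+-mono-≤-< (ℤ.≤-trans (ℤ.<⇒≤ 0<d) d≤a+b+c) 0<d
    }
  where
  w : Quad
  w = a ∷ b ∷ c ∷ d ∷ []
  eq : ∀ t d → t - d ≡ t + d - (d + d)
  eq = solve-∀
  0≤α₃ : 0ℤ ≤ α 3F w
  0≤α₃ = subst (0ℤ ≤_) (eq (a + b + c) d) (ℤ.i≤j⇒0≤j-i d≤a+b+c)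

root⁻⇒chamber : ∀ {x} → Root⁻ x → Chamber (neg x)
root⁻⇒chamber {x} (_ , _ , a , b , c , d , (_ , w↭x) , root) =
  chamber-↭ (neg x) (- d ∷ - c ∷ - b ∷ - a ∷ [])
    -- Negating an increasing quadruple makes it decreasing, so the quadruple in `Root⁻` is its
    -- reversal.
    (↭-trans (↭-reflexive (toList-map (-_) x))
    (↭-trans (map⁺ (-_) (↭-sym w↭x)) (↭-sym (↭-reverse (- a ∷ - b ∷ - c ∷ - d ∷ [])))))
    (root⁺⇒chamber root)

-- The reduction algorithm.

-- Reordering leaves the orbit, so the states of the reduction algorithm are
-- only rearrangements of orbit elements.
Shuffled : Quad → Quad → Set
Shuffled a w = ∃[ x ] (toList w ↭ toList x × Ascent a x)

shuffled-resp-↭ : ∀ {a w x} → toList w ↭ toList x → Shuffled a x → Shuffled a w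
shuffled-resp-↭ p (y , q , asc) = y , ↭-trans p q , asc

orders-∃ : ∀ x → ∃[ w ] w Orders x
orders-∃ x = go _ (trans (↭-length (sort-↭ (toList x))) (length-toList x)) (sort-↗ (toList x)) (sort-↭ (toList x))
  where
  go : ∀ ys → List.length ys ≡ 4 → Sorted ys → ys ↭ toList x → ∃[ w ] w Orders x
  go (a ∷ b ∷ c ∷ d ∷ []) refl sorted p = (a ∷ b ∷ c ∷ d ∷ []) , sorted , p

module _ {a : Quad} (chamber : Chamber a) where

  shuffled-positive : ∀ {w} → Shuffled a w → 0ℤ < L w
  shuffled-positive {w} (x , p , asc) = subst (0ℤ <_) (sym (L-↭ w x p)) (ascent-positive chamber asc)

  shuffled-s : ∀ i {w} → Shuffled a w → Shuffled a (s i w)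
  shuffled-s i {w} (x , p , asc) = let σ , _ , e = ↭⇒indices w x p in
    s (σ i) x , s-↭ w x p (e i) , ascent-s chamber (σ i) asc

  shuffled-pairs : ∀ {w} → Shuffled a w → ∀ {i j} → i ≢ j → 0ℤ ≤ α i w + α j w
  shuffled-pairs {w} (x , p , asc) {i} {j} i≢j = let σ , injective , e = ↭⇒indices w x p in
    subst (0ℤ ≤_) (sym (cong₂ _+_ (α-↭ w x p (e i)) (α-↭ w x p (e j)))) (ascent-pairs chamber asc (i≢j ∘ injective))

  -- A negative α at the underlying ascent point `x` would be one of `w` as well, and the matching
  -- reflection would decrease ‖ w ‖. So `x` is in the chamber and equals `a`.
  shuffled-reduced : ∀ {w} → Shuffled a w → Reduced w → toList w ↭ toList a
  shuffled-reduced {w} sh@(x , p , asc) red = let σ , _ , e = ↭⇒indices x w (↭-sym p) in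
    ↭-trans p (↭-reflexive (cong toList (ascent-unique chamber asc λ i →
      subst (0ℤ ≤_) (sym (α-↭ x w (↭-sym p) (e i))) (ℤ.≮⇒≥ λ α<0 →
        red (σ i) (α<0⇒decreases (σ i) w (shuffled-positive sh) (shuffled-positive (shuffled-s (σ i) sh)) α<0)))))

  -- A decreasing index i has αᵢ < 0 and the last entry of a sorted quadruple has
  -- the least α, so i ≠ 3F would give two negative values, with a negative sum.
  decreases⇒last : ∀ i {w} → Shuffled a w → Sorted (toList w) → Decreases i w → i ≡ 3F
  decreases⇒last i {w} sh sorted dec with i ≟ᶠ 3F
  ... | yes i≡3F = i≡3F
  ... | no i≢3F  = contradiction (shuffled-pairs sh i≢3F)
    (ℤ.<⇒≱ (ℤ.+-mono-< α<0 (ℤ.≤-<-trans (α-antitone w {i} {3F} (sorted⇒≤last w sorted i)) α<0)))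
    where
    α<0 : α i w < 0ℤ
    α<0 = decreases⇒α<0 i w (shuffled-positive sh) (shuffled-positive (shuffled-s i sh)) dec

  shuffled-S : ∀ i {w} → Shuffled a w → Shuffled a (S i · w)
  shuffled-S i {w} sh = subst (Shuffled a) (sym (S·x≡s i w)) (shuffled-s i sh)

  -- Recursion on the norm, which sorting does not change. Testing S₄ alone decides whether to halt,
  -- since no other index can decrease a sorted state.
  run-exists : ∀ x → Shuffled a x → Acc _<ᴺ_ ‖ x ‖ → ∃[ is ] ∃[ r ] Run x is r
  run-exists x sh (acc rec) with orders-∃ x
  ... | w , orders@(sorted , w↭x) with ‖ S 3F · w ‖ ℕ.<? ‖ w ‖
  ...   | no ¬dec = [] , w , halt orders λ i dec →
    ¬dec (subst (λ j → Decreases j w) (decreases⇒last i (shuffled-resp-↭ w↭x sh) sorted dec) dec)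
  ...   | yes dec =
    let sh′         = shuffled-resp-↭ w↭x sh
        is , r , run = run-exists (S 3F · w) (shuffled-S 3F sh′)
                         (rec (subst (‖ S 3F · w ‖ <ᴺ_) (‖‖-↭ w x w↭x) dec))
    -- Any earlier decreasing index would have to be 3F itself, so S₄ is the first.
    in 3F ∷ is , r , step orders (dec , λ j j<3 dec′ → <ᶠ-irrefl (decreases⇒last j sh′ sorted dec′) j<3) run

  -- Induction over an arbitrary run: every state stays a rearrangement of an ascent point, so each
  -- step uses the last index and the halting state rearranges `a`.
  run-result : ∀ {x is r} → Shuffled a x → Run x is r → All (_≡ 3F) is × r Orders a
  run-result sh (halt (sorted , w↭x) red) = [] , sorted , shuffled-reduced (shuffled-resp-↭ w↭x sh) red
  run-result sh (step {i = i} (sorted , w↭x) (dec , _) run) =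
    let sh′      = shuffled-resp-↭ w↭x sh
        all , ord = run-result (shuffled-S i sh′) run
    in decreases⇒last i sh′ sorted dec ∷ all , ord

theorem3p2 : ∀ (v : Quad) → v ≢ replicate 4 0ℤ →
    ∀ (a : Quad) → a ∈𝒜[ v ] → Root a →
    (Reduced a × (∀ x → x ∈𝒜[ v ] → Reduced x → x ≡ a))
    × ((∀ x → x ∈𝒜[ v ] → 0ℤ < L x) ⊎ (∀ x → x ∈𝒜[ v ] → L x < 0ℤ))
    × ((∀ x → x ∈𝒜[ v ] → 0ℤ < L x) →
    ∀ x → x ∈𝒜[ v ] →
    (∃[ is ] ∃[ r ] Run x is r)
    × (∀ is r → Run x is r → All (_≡ 3F) is × r Orders a))
theorem3p2 v _ a a∈𝒜v (inj₁ root) =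
  (proj₁ root , λ x x∈𝒜v → ascent-reduced chamber (ascent x x∈𝒜v)) ,
  inj₁ (λ x x∈𝒜v → ascent-positive chamber (ascent x x∈𝒜v)) ,
  λ _ x x∈𝒜v → let sh = x , ↭-refl , ascent x x∈𝒜v in
    run-exists chamber x sh (<-wellFounded ‖ x ‖) , λ _ _ → run-result chamber sh
  where
  chamber : Chamber a
  chamber = root⁺⇒chamber root
  ascent : ∀ x → x ∈𝒜[ v ] → Ascent a x
  ascent = orbit⊆ascent chamber a∈𝒜v
theorem3p2 v _ a a∈𝒜v (inj₂ root) =
  (proj₁ root , λ x x∈𝒜v red → trans (sym (neg-involutive x)) (trans
    (cong neg (ascent-reduced chamber (ascent x x∈𝒜v) (reduced-neg red))) (neg-involutive a))) ,
  inj₂ negative ,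
  -- Here L is negative at `a` itself, so the positive case cannot arise.
  λ positive → contradiction (positive a a∈𝒜v) (ℤ.<-asym (negative a a∈𝒜v))
  where
  chamber : Chamber (neg a)
  chamber = root⁻⇒chamber root
  ascent : ∀ x → x ∈𝒜[ v ] → Ascent (neg a) (neg x)
  ascent = orbit⊆-ascent chamber a∈𝒜v
  negative : ∀ x → x ∈𝒜[ v ] → L x < 0ℤ
  negative x x∈𝒜v = ℤ.neg-cancel-< (subst (0ℤ <_) (L-neg x) (ascent-positive chamber (ascent x x∈𝒜v)))
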